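{- Let $m\ge2$. If $\{B_i : 1\leq i\leq m\}$ is an $(n,m;c_1,c_2,\dots,c_l;w_1,w_2,\dots,w_l;\lambda_1,\lambda_2,\dots,\lambda_l)$-PEDF, then $\{B_i : 1\leq i\leq m\}$ is an $(n,m,K=(|B_1|,|B_2|,\dots,|B_m|),a,\lambda)$-SWEDF, where $a=\sum_i|B_i|$, $\widetilde{k}=\mathrm{lcm}(w_1,w_2,\dots,w_l)$ and $\lambda=\sum_{1\leq t\leq l}\frac{\lambda_t\widetilde{k}}{w_t}$.
   Context: Let $G$ be an additive Abelian group of order $n$ with identity $0$. For multi-sets $B_1,B_2$ of elements of $G$, $D(B_1,B_2)$ is the multi-set $\{x-y : x\in B_1,\ y\in B_2\}$; $c\boxtimes B$ is the multi-set in which each element of $B$ is repeated $c$ times; unions are multi-set unions. Let $\mathcal{B}=\{B_i : 1\le i\le m\}$ be a family of pairwise disjoint nonempty subsets of $G$ with $k_i=|B_i|$. $\mathcal{B}$ is an $(n,m;c_1,\dots,c_l;w_1,\dots,w_l;\lambda_1,\dots,\lambda_l)$-partitioned external difference family (PEDF) if $w_1,\dots,w_l$ are the distinct sizes of the sets in $\mathcal{B}$, $c_t=|\{i : |B_i|=w_t,\ 1\le i\le m\}|$ for $1\le t\le l$, and for each $1\le t\le l$, $\bigcup_{\{i:|B_i|=w_t\}}\bigcup_{1\le j\le m,\ j\ne i}D(B_i,B_j)=\lambda_t\boxtimes(G\setminus\{0\})$. With $K=(k_1,\dots,k_m)$, $a=\sum_i k_i$, $\widetilde{k}=\mathrm{lcm}(k_1,\dots,k_m)$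 and $\widetilde{B}_i=\frac{\widetilde{k}}{k_i}\boxtimes B_i$, $\mathcal{B}$ is an $(n,m,K,a,\lambda)$-SWEDF (standard weighted external difference family), $\lambda$ a positive integer, if $\bigcup_{1\le i\ne j\le m}D(B_i,\widetilde{B}_j)=\lambda\boxtimes(G\setminus\{0\})$. -}

module Defs where

open import Algebra.Bundles using (AbelianGroup)
open import Algebra.Properties.CommutativeMonoid.Sum using (sum)
open import Data.Fin.Base using (Fin)
import Data.Fin.Properties as Fin
open import Data.List.Base
  using (List; []; _∷_; length; filter; replicate; concatMap; tabulate; allFin; cartesianProductWith)
import Data.List.Relation.Binary.Disjoint.Setoid as Disjointness
import Data.List.Relation.Binary.Permutation.Setoid as Permutation
import Data.List.Relation.Unary.Unique.Setoid as Uniqueness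
open import Data.Nat.Base using (ℕ; NonZero; _>_; _/_)
open import Data.Nat.LCM using (lcm)
open import Data.Nat.Properties using (_≟_; +-0-commutativeMonoid)
open import Data.Product.Base using (∃; _,_)
import Data.Vec.Functional as Vector
open import Function.Bundles using (Inverse)
open import Function.Definitions using (Injective)
open import Function.Properties.Inverse using (Inverse⇒Injection)
open import Level using (Level; _⊔_)
open import Relation.Binary.Definitions using (Decidable)
open import Relation.Binary.PropositionalEquality using (_≡_; _≢_; refl; subst; setoid)
open import Relation.Nullary.Decidable using (¬?)
open import Relation.Nullary.Negation using (contradiction)

∑ : ∀ {k} → (Fin k → ℕ) → ℕ
∑ = sum +-0-commutativeMonoid

lcms : ∀ {k} → (Fin k → ℕ) → ℕ
lcms = Vector.foldr lcm 1

HasOrder : ∀ {g ℓ} → AbelianGroup g ℓ → ℕ → Set (g ⊔ ℓ)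
HasOrder G n = Inverse (AbelianGroup.setoid G) (setoid (Fin n))

module DifferenceFamilies {g ℓ : Level} (G : AbelianGroup g ℓ) {n : ℕ} (order : HasOrder G n) where

  open AbelianGroup G using (Carrier; _≈_; _-_; ε) renaming (setoid to G-setoid)
  open Disjointness G-setoid using (Disjoint)
  open Permutation G-setoid using (_↭_)
  open Uniqueness G-setoid using (Unique)

  _≈?_ : Decidable _≈_
  _≈?_ = Fin.inj⇒≟ (Inverse⇒Injection order)

  -- A multiset is a list; two multisets are equal when the lists are related by _↭_.
  Multiset : Set g
  Multiset = List Carrier

  D : Multiset → Multiset → Multiset
  D = cartesianProductWith _-_

  infixr 7 _⊠_
  _⊠_ : ℕ → Multiset → Multiset
  c ⊠ B = concatMap (replicate c) B

  ⋃ : ∀ {a} {I : Set a} → List I → (I → Multiset) → Multiset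
  ⋃ is F = concatMap F is

  G∖0 : Multiset
  G∖0 = filter (λ x → ¬? (x ≈? ε)) (tabulate (Inverse.from order))

  -- A finite subset of G is a list without repetitions.
  record Family (m : ℕ) : Set (g ⊔ ℓ) where
    field
      set      : Fin m → List Carrier
      unique   : ∀ i → Unique (set i)
      nonempty : ∀ i → set i ≢ []
      disjoint : ∀ i j → i ≢ j → Disjoint (set i) (set j)

    size : Fin m → ℕ
    size i = length (set i)

    size-nonZero : ∀ i → NonZero (size i)
    size-nonZero i with set i | nonempty i
    ... | []    | ≢[] = contradiction refl ≢[]
    ... | _ ∷ _ | _   = _

    indicesOfSize : ℕ → List (Fin m)
    indicesOfSize s = filter (λ i → size i ≟ s) (allFin m)

    indicesExcept : Fin m → List (Fin m)
    indicesExcept i = filter (λ j → ¬? (j Fin.≟ i)) (allFin m)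

    k̃ : ℕ
    k̃ = lcms size

    -- The division is exact, since size i divides k̃.
    weighted : Fin m → Multiset
    weighted i = (_/_ k̃ (size i) {{size-nonZero i}}) ⊠ set i

  record IsPEDF {m l : ℕ} (𝓑 : Family m) (c w Λ : Fin l → ℕ) : Set (g ⊔ ℓ) where
    open Family 𝓑
    field
      w-distinct  : Injective _≡_ _≡_ w
      w-isSize    : ∀ t → ∃ λ i → size i ≡ w t
      w-allSizes  : ∀ i → ∃ λ t → size i ≡ w t
      c-count     : ∀ t → c t ≡ length (indicesOfSize (w t))
      differences : ∀ t →
        ⋃ (indicesOfSize (w t)) (λ i → ⋃ (indicesExcept i) λ j → D (set i) (set j))
          ↭ Λ t ⊠ G∖0

    w-nonZero : ∀ t → NonZero (w t)
    w-nonZero t with i , size≡w ← w-isSize t = subst NonZero size≡w (size-nonZero i)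

  record IsSWEDF {m : ℕ} (𝓑 : Family m) (K : Fin m → ℕ) (a Λ : ℕ) : Set (g ⊔ ℓ) where
    open Family 𝓑
    field
      K-sizes     : ∀ i → K i ≡ size i
      a-total     : a ≡ ∑ K
      Λ-positive  : Λ > 0
      differences :
        ⋃ (allFin m) (λ i → ⋃ (indicesExcept i) λ j → D (set i) (weighted j))
          ↭ Λ ⊠ G∖0

{-# OPTIONS --safe #-}
-- A multiset is determined by the sums over it of all ≈-respecting weights f : G → ℕ.
-- Summing f over the weighted external differences gives ∑ⱼ (k̃ / kⱼ) ∑_{i≠j} f(Bᵢ − Bⱼ).
-- The weight sits on the second block, while the PEDF condition groups by the first,
-- so f is replaced by f ∘ _⁻¹, which exchanges the two blocks and leaves the sum over
-- G∖0 unchanged. Grouping j by size then turns the sum into ∑ₜ (k̃ / wₜ) λₜ f(G∖0).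
module Submission where

open import Defs
open import Algebra.Bundles using (AbelianGroup)
import Algebra.Properties.CommutativeMonoid.Sum as CMSum
import Algebra.Properties.CommutativeSemigroup as CommutativeSemigroupProperties
import Algebra.Properties.Group as GroupProperties
import Algebra.Properties.Semiring.Sum as SemiringSum
open import Data.Bool.Base using (true; false; if_then_else_)
open import Data.Fin.Base using (Fin; zero; suc; punchIn)
import Data.Fin.Permutation as Perm
import Data.Fin.Properties as Fin
open import Data.List.Base
  using (List; []; _∷_; _++_; map; filter; replicate; concatMap; tabulate; allFin)
open import Data.List.Membership.Propositional using (_∈_)
open import Data.List.Membership.Propositional.Properties
  using (∈-concatMap⁺; ∈-cartesianProductWith⁺; ∈-filter⁺; ∈-allFin)
import Data.List.Membership.Setoid as SetoidMembership
import Data.List.Membership.Setoid.Properties as SetoidMembershipₚ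
open import Data.List.Properties using (map-++; map-∘)
open import Data.List.Relation.Binary.Permutation.Propositional using (↭ₛ⇒↭)
import Data.List.Relation.Binary.Permutation.Setoid as Permutation
import Data.List.Relation.Binary.Permutation.Setoid.Properties as Permutationₚ
open import Data.List.Relation.Unary.Any using (here; there)
import Data.List.Relation.Unary.Any as Any
open import Data.Nat.Base
open import Data.Nat.Divisibility
  using (_∣_; ∣-trans; ∣-antisym; ∣-reflexive; ∣⇒≤; 1∣_)
open import Data.Nat.DivMod using (*-/-assoc; /-congˡ; /-congʳ; m≥n⇒m/n>0)
open import Data.Nat.GCD using (gcd)
open import Data.Nat.LCM using (lcm; m∣lcm[m,n]; n∣lcm[m,n]; lcm-least; gcd*lcm)
open import Data.Nat.ListAction using (sum)
open import Data.Nat.ListAction.Properties using (sum-++; sum-↭)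
open import Data.Nat.Properties
open import Data.Product.Base using (∃; _,_; proj₁; proj₂)
open import Function.Base using (_∘_; id)
open import Function.Bundles using (Inverse)
open import Function.Definitions using (Injective)
open import Level using (Level)
open import Relation.Binary.Core using (_Preserves_⟶_)
open import Relation.Binary.PropositionalEquality
  using (_≡_; _≢_; refl; sym; trans; cong; cong₂; subst; setoid; module ≡-Reasoning)
open import Relation.Nullary.Decidable using (Dec; yes; no; does; ¬?)
open import Relation.Nullary.Negation using (¬_; contradiction)
open import Relation.Unary using (Pred; Decidable)

private
  variable
    a p : Level
    A B : Set a
    P Q : Set p

open CMSum +-0-commutativeMonoid
  using (sum-cong-≗; sum-remove; sum-permute; sum-replicate-zero)
open CommutativeSemigroupProperties +-commutativeSemigroup using (interchange)
open SemiringSum +-*-semiring using (*-distribʳ-sum)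

-- Indicators and sums over finite index sets.

indicator : Dec P → ℕ
indicator d = if does d then 1 else 0

indicator-true : (d : Dec P) → P → indicator d ≡ 1
indicator-true (yes _) _ = refl
indicator-true (no ¬p) p = contradiction p ¬p

indicator-false : (d : Dec P) → ¬ P → indicator d ≡ 0
indicator-false (yes p) ¬p = contradiction p ¬p
indicator-false (no _)  _  = refl

indicator-cong : (d : Dec P) (e : Dec Q) → (P → Q) → (Q → P) → indicator d ≡ indicator e
indicator-cong (yes _) (yes _) _  _  = refl
indicator-cong (yes p) (no ¬q) to _  = contradiction (to p) ¬q
indicator-cong (no ¬p) (yes q) _  fr = contradiction (fr q) ¬p
indicator-cong (no _)  (no _)  _  _  = refl

∑-single : ∀ {k} (f : Fin k → ℕ) i → (∀ j → i ≢ j → f j ≡ 0) → ∑ f ≡ f i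
∑-single {suc k} f i zeros = begin
  ∑ f                               ≡⟨ sum-remove {i = i} f ⟩
  f i + ∑ (λ j → f (punchIn i j))   ≡⟨ cong (f i +_) (sum-cong-≗ λ j → zeros _ (Fin.punchInᵢ≢i i j ∘ sym)) ⟩
  f i + ∑ {k} (λ _ → 0)             ≡⟨ cong (f i +_) (sum-replicate-zero k) ⟩
  f i + 0                           ≡⟨ +-identityʳ (f i) ⟩
  f i                               ∎
  where open ≡-Reasoning

term≤∑ : ∀ {k} (f : Fin k → ℕ) i → f i ≤ ∑ f
term≤∑ {suc k} f i = subst (f i ≤_) (sym (sum-remove {i = i} f)) (m≤m+n (f i) _)

-- Sums of weights over lists.

sumOver : (A → ℕ) → List A → ℕ
sumOver f xs = sum (map f xs)

sumOver-cong : ∀ {f g : A → ℕ} → (∀ x → f x ≡ g x) → ∀ xs → sumOver f xs ≡ sumOver g xs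
sumOver-cong f≗g []       = refl
sumOver-cong f≗g (x ∷ xs) = cong₂ _+_ (f≗g x) (sumOver-cong f≗g xs)

sumOver-zero : (xs : List A) → sumOver (λ _ → 0) xs ≡ 0
sumOver-zero []       = refl
sumOver-zero (_ ∷ xs) = sumOver-zero xs

sumOver-+ : ∀ (f g : A → ℕ) xs → sumOver (λ x → f x + g x) xs ≡ sumOver f xs + sumOver g xs
sumOver-+ f g []       = refl
sumOver-+ f g (x ∷ xs) =
  trans (cong (f x + g x +_) (sumOver-+ f g xs)) (interchange (f x) (g x) _ _)

sumOver-*ˡ : ∀ c (f : A → ℕ) xs → sumOver (λ x → c * f x) xs ≡ c * sumOver f xs
sumOver-*ˡ c f []       = sym (*-zeroʳ c)
sumOver-*ˡ c f (x ∷ xs) =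
  trans (cong (c * f x +_) (sumOver-*ˡ c f xs)) (sym (*-distribˡ-+ c (f x) _))

sumOver-comm : ∀ (f : A → B → ℕ) xs ys →
  sumOver (λ x → sumOver (f x) ys) xs ≡ sumOver (λ y → sumOver (λ x → f x y) xs) ys
sumOver-comm f []       ys = sym (sumOver-zero ys)
sumOver-comm f (x ∷ xs) ys =
  trans (cong (sumOver (f x) ys +_) (sumOver-comm f xs ys)) (sym (sumOver-+ (f x) _ ys))

sumOver-++ : ∀ (f : A → ℕ) xs ys → sumOver f (xs ++ ys) ≡ sumOver f xs + sumOver f ys
sumOver-++ f xs ys = trans (cong sum (map-++ f xs ys)) (sum-++ (map f xs) (map f ys))

sumOver-map : ∀ (f : B → ℕ) (g : A → B) xs → sumOver f (map g xs) ≡ sumOver (f ∘ g) xs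
sumOver-map f g xs = cong sum (sym (map-∘ xs))

sumOver-concatMap : ∀ (f : B → ℕ) (F : A → List B) xs →
  sumOver f (concatMap F xs) ≡ sumOver (λ x → sumOver f (F x)) xs
sumOver-concatMap f F []       = refl
sumOver-concatMap f F (x ∷ xs) =
  trans (sumOver-++ f (F x) _) (cong (sumOver f (F x) +_) (sumOver-concatMap f F xs))

sumOver-replicate : ∀ (f : A → ℕ) c x → sumOver f (replicate c x) ≡ c * f x
sumOver-replicate f zero    x = refl
sumOver-replicate f (suc c) x = cong (f x +_) (sumOver-replicate f c x)

sumOver-tabulate : ∀ {k} (f : A → ℕ) (g : Fin k → A) → sumOver f (tabulate g) ≡ ∑ (f ∘ g)
sumOver-tabulate {k = zero}  f g = refl
sumOver-tabulate {k = suc k} f g = cong (f (g zero) +_) (sumOver-tabulate f (g ∘ suc))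

∈⇒≤sumOver : ∀ (f : A → ℕ) {x xs} → x ∈ xs → f x ≤ sumOver f xs
∈⇒≤sumOver f (here refl)          = m≤m+n _ _
∈⇒≤sumOver f (there {x = y} x∈xs) = m≤n⇒m≤o+n (f y) (∈⇒≤sumOver f x∈xs)

module _ {P : Pred A p} (P? : Decidable P) where

  sumOver-filter : ∀ (f : A → ℕ) xs →
    sumOver f (filter P? xs) ≡ sumOver (λ x → indicator (P? x) * f x) xs
  sumOver-filter f []       = refl
  sumOver-filter f (x ∷ xs) with does (P? x)
  ... | true  = cong₂ _+_ (sym (*-identityˡ (f x))) (sumOver-filter f xs)
  ... | false = sumOver-filter f xs

  sumOver-filter-cong : ∀ {f g : A → ℕ} → (∀ x → P x → f x ≡ g x) →
    ∀ xs → sumOver f (filter P? xs) ≡ sumOver g (filter P? xs)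
  sumOver-filter-cong         f≗g []       = refl
  sumOver-filter-cong {f} {g} f≗g (x ∷ xs) with P? x
  ... | yes px = cong₂ _+_ (f≗g x px) (sumOver-filter-cong f≗g xs)
  ... | no _   = sumOver-filter-cong f≗g xs

-- The inner range depends on the outer variable, so the sums cannot be exchanged directly. Writing
-- each filter as an indicator factor makes both ranges constant; the equivalence of `R x y` and
-- `S y x` then matches the two indicators.
sumOver-filter-comm : ∀ {R : A → B → Set p} {S : B → A → Set p}
  (R? : ∀ x → Decidable (R x)) (S? : ∀ y → Decidable (S y)) →
  (∀ {x y} → R x y → S y x) → (∀ {x y} → S y x → R x y) →
  ∀ (f : A → B → ℕ) xs ys →
  sumOver (λ x → sumOver (f x) (filter (R? x) ys)) xs ≡
  sumOver (λ y → sumOver (λ x → f x y) (filter (S? y) xs)) ys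
sumOver-filter-comm R? S? R⇒S S⇒R f xs ys = begin
  sumOver (λ x → sumOver (f x) (filter (R? x) ys)) xs
    ≡⟨ sumOver-cong (λ x → sumOver-filter (R? x) (f x) ys) xs ⟩
  sumOver (λ x → sumOver (λ y → indicator (R? x y) * f x y) ys) xs
    ≡⟨ sumOver-comm _ xs ys ⟩
  sumOver (λ y → sumOver (λ x → indicator (R? x y) * f x y) xs) ys
    ≡⟨ sumOver-cong (λ y → sumOver-cong (λ x →
         cong (_* f x y) (indicator-cong (R? x y) (S? y x) R⇒S S⇒R)) xs) ys ⟩
  sumOver (λ y → sumOver (λ x → indicator (S? y x) * f x y) xs) ys
    ≡⟨ sumOver-cong (λ y → sumOver-filter (S? y) (λ x → f x y) xs) ys ⟨
  sumOver (λ y → sumOver (λ x → f x y) (filter (S? y) xs)) ys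
    ∎
  where open ≡-Reasoning

-- Every `x` lies in exactly one fibre: `hit` provides one and injectivity of `w` excludes a second.
-- Hence the indicators of `s x ≟ w t` add up to 1 over `t`, and inserting this factor before
-- exchanging the sums splits the total by the value of `s`.
sumOver-fibres : ∀ {l} (s : A → ℕ) (w : Fin l → ℕ) → Injective _≡_ _≡_ w →
  (∀ x → ∃ λ t → s x ≡ w t) → ∀ (f : A → ℕ) xs →
  sumOver f xs ≡ ∑ (λ t → sumOver f (filter (λ x → s x ≟ w t) xs))
sumOver-fibres {l = l} s w w-inj hit f xs = begin
  sumOver f xs
    ≡⟨ sumOver-cong (λ x → sym (once x)) xs ⟩
  sumOver (λ x → sumOver (λ t → indicator (s x ≟ w t) * f x) (allFin l)) xs
    ≡⟨ sumOver-comm _ xs (allFin l) ⟩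
  sumOver (λ t → sumOver (λ x → indicator (s x ≟ w t) * f x) xs) (allFin l)
    ≡⟨ sumOver-cong (λ t → sumOver-filter (λ x → s x ≟ w t) f xs) (allFin l) ⟨
  sumOver (λ t → sumOver f (filter (λ x → s x ≟ w t) xs)) (allFin l)
    ≡⟨ sumOver-tabulate {k = l} _ id ⟩
  ∑ (λ t → sumOver f (filter (λ x → s x ≟ w t) xs))
    ∎
  where
  open ≡-Reasoning
  once : ∀ x → sumOver (λ t → indicator (s x ≟ w t) * f x) (allFin l) ≡ f x
  once x with t , sx≡wt ← hit x = begin
    sumOver (λ u → indicator (s x ≟ w u) * f x) (allFin l)
      ≡⟨ sumOver-tabulate {k = l} _ id ⟩
    ∑ (λ u → indicator (s x ≟ w u) * f x)
      ≡⟨ ∑-single _ t (λ u t≢u → cong (_* f x)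
           (indicator-false (s x ≟ w u) λ sx≡wu → t≢u (w-inj (trans (sym sx≡wt) sx≡wu)))) ⟩
    indicator (s x ≟ w t) * f x
      ≡⟨ cong (_* f x) (indicator-true (s x ≟ w t) sx≡wt) ⟩
    1 * f x
      ≡⟨ *-identityˡ (f x) ⟩
    f x ∎

-- Least common multiples of finite families.

lcms-∣ : ∀ {k} (v : Fin k → ℕ) i → v i ∣ lcms v
lcms-∣ v zero    = m∣lcm[m,n] (v zero) _
lcms-∣ v (suc i) = ∣-trans (lcms-∣ (v ∘ suc) i) (n∣lcm[m,n] (v zero) _)

lcms-least : ∀ {k} (v : Fin k → ℕ) {d} → (∀ i → v i ∣ d) → lcms v ∣ d
lcms-least {zero}  v v∣d = 1∣ _
lcms-least {suc k} v v∣d = lcm-least (v∣d zero) (lcms-least (v ∘ suc) (v∣d ∘ suc))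

-- Each side is a common multiple of the other family, so the two divide one another. Multiplicities
-- are irrelevant, which lets the lcm over all blocks be compared with the lcm over the distinct
-- sizes.
lcms-cong : ∀ {k l} (u : Fin k → ℕ) (v : Fin l → ℕ) →
  (∀ i → ∃ λ j → u i ≡ v j) → (∀ j → ∃ λ i → u i ≡ v j) → lcms u ≡ lcms v
lcms-cong u v u⊆v v⊆u = ∣-antisym
  (lcms-least u λ i → let j , eq = u⊆v i in ∣-trans (∣-reflexive eq) (lcms-∣ v j))
  (lcms-least v λ j → let i , eq = v⊆u j in ∣-trans (∣-reflexive (sym eq)) (lcms-∣ u i))

-- The lcm is a factor of `m * n`, the cofactor being the gcd.
lcm-nonZero : ∀ m n → .{{NonZero m}} → .{{NonZero n}} → NonZero (lcm m n)
lcm-nonZero m n = m*n≢0⇒n≢0 (gcd m n) {{subst NonZero (sym (gcd*lcm m n)) (m*n≢0 m n)}}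

lcms-nonZero : ∀ {k} (v : Fin k → ℕ) → (∀ i → NonZero (v i)) → NonZero (lcms v)
lcms-nonZero {zero}  v v≢0 = _
lcms-nonZero {suc k} v v≢0 =
  lcm-nonZero (v zero) _ {{v≢0 zero}} {{lcms-nonZero (v ∘ suc) (v≢0 ∘ suc)}}

module _ {g ℓ : Level} (G : AbelianGroup g ℓ) {n : ℕ} (order : HasOrder G n) where

  open DifferenceFamilies G order
  open AbelianGroup G
    using (Carrier; _≈_; _-_; _⁻¹; ε; ⁻¹-cong; group)
    renaming (setoid to G-setoid; refl to ≈-refl; sym to ≈-sym; trans to ≈-trans)
  open GroupProperties group using (⁻¹-involutive; ⁻¹-anti-homo-//; ε⁻¹≈ε)
  open Permutation G-setoid using (_↭_; ↭-refl; ↭-sym; ↭-trans; ↭-prep; ↭-reflexive-≋)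
  open Permutationₚ G-setoid using (map⁺; shift)
  open SetoidMembership G-setoid using () renaming (_∈_ to _∈≈_)
  open SetoidMembershipₚ using (∈-∃++)
  private module O = Inverse order

  -- Multisets of group elements and the weights that separate them.

  Respects≈ : (Carrier → ℕ) → Set _
  Respects≈ f = f Preserves _≈_ ⟶ _≡_

  sumOver-↭ : ∀ {f} → Respects≈ f → ∀ {xs ys} → xs ↭ ys → sumOver f xs ≡ sumOver f ys
  sumOver-↭ f-cong xs↭ys = sum-↭ (↭ₛ⇒↭ (map⁺ (setoid ℕ) f-cong xs↭ys))

  sumOver-indicator>0⇒∈ : ∀ x ys → 0 < sumOver (λ y → indicator (x ≈? y)) ys → x ∈≈ ys
  sumOver-indicator>0⇒∈ x (y ∷ ys) pos with x ≈? y
  ... | yes x≈y = here x≈y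
  ... | no x≉y  = there (sumOver-indicator>0⇒∈ x ys
    (subst (λ b → 0 < b + _) (indicator-false (x ≈? y) x≉y) pos))

  ∈⇒↭-head : ∀ {x ys} → x ∈≈ ys → ∃ λ zs → ys ↭ x ∷ zs
  ∈⇒↭-head x∈ys with us , vs , _ , x≈w , ys≋ ← ∈-∃++ G-setoid x∈ys =
    -- The occurrence found is some `w` with `x ≈ w`; `shift` moves it to the front and replaces it
    -- by `x` at once.
    us ++ vs , ↭-trans (↭-reflexive-≋ ys≋) (shift (≈-sym x≈w) us vs)

  -- Induction on `xs`. The indicator of the class of the head `x` has a positive sum on the left,
  -- hence on the right, so `x` occurs in `ys`. Moving it to the front there and cancelling `f x`
  -- leaves the same hypothesis for the tails. When `xs` is empty, the constant weight 1 compares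
  -- lengths.
  sumOver≡⇒↭ : ∀ xs ys → (∀ f → Respects≈ f → sumOver f xs ≡ sumOver f ys) → xs ↭ ys
  sumOver≡⇒↭ []       []       _  = ↭-refl
  sumOver≡⇒↭ []       (y ∷ ys) eq = contradiction (eq (λ _ → 1) (λ _ → refl)) λ ()
  sumOver≡⇒↭ (x ∷ xs) ys       eq = ↭-trans (↭-prep x xs↭zs) (↭-sym ys↭x∷zs)
    where
    δ-cong : Respects≈ (λ y → indicator (x ≈? y))
    δ-cong {y} {z} y≈z =
      indicator-cong (x ≈? y) (x ≈? z) (λ e → ≈-trans e y≈z) (λ e → ≈-trans e (≈-sym y≈z))

    x∈ys : x ∈≈ ys
    x∈ys = sumOver-indicator>0⇒∈ x ys (subst (0 <_) (eq _ δ-cong)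
      (≤-trans (≤-reflexive (sym (indicator-true (x ≈? x) ≈-refl))) (m≤m+n _ _)))

    zs      = proj₁ (∈⇒↭-head x∈ys)
    ys↭x∷zs = proj₂ (∈⇒↭-head x∈ys)

    xs↭zs : xs ↭ zs
    xs↭zs = sumOver≡⇒↭ xs zs λ f f-cong →
      +-cancelˡ-≡ (f x) _ _ (trans (eq f f-cong) (sumOver-↭ f-cong ys↭x∷zs))

  -- Sums over repeated multisets, difference multisets and `G∖0`.

  sumOver-⊠ : ∀ f c X → sumOver f (c ⊠ X) ≡ c * sumOver f X
  sumOver-⊠ f c X = begin
    sumOver f (c ⊠ X)                              ≡⟨ sumOver-concatMap f (replicate c) X ⟩
    sumOver (λ x → sumOver f (replicate c x)) X    ≡⟨ sumOver-cong (sumOver-replicate f c) X ⟩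
    sumOver (λ x → c * f x) X                      ≡⟨ sumOver-*ˡ c f X ⟩
    c * sumOver f X                                ∎
    where open ≡-Reasoning

  sumOver-D : ∀ f X Y → sumOver f (D X Y) ≡ sumOver (λ x → sumOver (λ y → f (x - y)) Y) X
  sumOver-D f []      Y = refl
  sumOver-D f (x ∷ X) Y = trans (sumOver-++ f (map (x -_) Y) _)
    (cong₂ _+_ (sumOver-map f (x -_) Y) (sumOver-D f X Y))

  sumOver-D-⊠ : ∀ f X c Y → sumOver f (D X (c ⊠ Y)) ≡ c * sumOver f (D X Y)
  sumOver-D-⊠ f X c Y = begin
    sumOver f (D X (c ⊠ Y))                             ≡⟨ sumOver-D f X (c ⊠ Y) ⟩
    sumOver (λ x → sumOver (λ y → f (x - y)) (c ⊠ Y)) X ≡⟨ sumOver-cong (λ x → sumOver-⊠ _ c Y) X ⟩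
    sumOver (λ x → c * sumOver (λ y → f (x - y)) Y) X   ≡⟨ sumOver-*ˡ c _ X ⟩
    c * sumOver (λ x → sumOver (λ y → f (x - y)) Y) X   ≡⟨ cong (c *_) (sumOver-D f X Y) ⟨
    c * sumOver f (D X Y)                               ∎
    where open ≡-Reasoning

  -- Pairwise this is the identity that `x - y` is the inverse of `y - x`.
  sumOver-D-swap : ∀ {f} → Respects≈ f → ∀ X Y →
    sumOver f (D X Y) ≡ sumOver (f ∘ _⁻¹) (D Y X)
  sumOver-D-swap {f} f-cong X Y = begin
    sumOver f (D X Y)
      ≡⟨ sumOver-D f X Y ⟩
    sumOver (λ x → sumOver (λ y → f (x - y)) Y) X
      ≡⟨ sumOver-comm _ X Y ⟩
    sumOver (λ y → sumOver (λ x → f (x - y)) X) Y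
      ≡⟨ sumOver-cong (λ y → sumOver-cong (λ x → f-cong (⁻¹-anti-homo-// y x)) X) Y ⟨
    sumOver (λ y → sumOver (λ x → f ((y - x) ⁻¹)) X) Y
      ≡⟨ sumOver-D (f ∘ _⁻¹) Y X ⟨
    sumOver (f ∘ _⁻¹) (D Y X)
      ∎
    where open ≡-Reasoning

  -- Inversion in `G`, transported to `Fin n` along `order` because `G∖0` is enumerated there and
  -- `sum-permute` acts on index sums. It is an involution, so it serves as its own two-sided
  -- inverse.
  negation : Perm.Permutation′ n
  negation = Perm.permutation neg neg neg-neg neg-neg
    where
    neg : Fin n → Fin n
    neg i = O.to (O.from i ⁻¹)

    neg-neg : ∀ i → neg (neg i) ≡ i
    neg-neg i = O.inverseˡ (≈-trans (⁻¹-cong (O.strictlyInverseʳ _)) (⁻¹-involutive _))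

  sumOver-G∖0-⁻¹ : ∀ {f} → Respects≈ f → sumOver (f ∘ _⁻¹) G∖0 ≡ sumOver f G∖0
  sumOver-G∖0-⁻¹ {f} f-cong = begin
    sumOver (f ∘ _⁻¹) G∖0
      ≡⟨ sumOver-filter (λ x → ¬? (x ≈? ε)) (f ∘ _⁻¹) (tabulate O.from) ⟩
    sumOver (λ x → indicator (¬? (x ≈? ε)) * f (x ⁻¹)) (tabulate O.from)
      ≡⟨ sumOver-tabulate _ O.from ⟩
    ∑ (λ i → indicator (¬? (O.from i ≈? ε)) * f (O.from i ⁻¹))
      -- First the indicator is moved from `x` to its inverse; then the inverse is replaced by its
      -- round trip through `Fin n`, the form in which `negation` appears.
      ≡⟨ sum-cong-≗ (λ i → trans (h-⁻¹ (O.from i)) (h-cong (≈-sym (O.strictlyInverseʳ _)))) ⟩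
    ∑ (λ i → h (O.from (negation Perm.⟨$⟩ʳ i)))
      ≡⟨ sum-permute (h ∘ O.from) negation ⟨
    ∑ (h ∘ O.from)
      ≡⟨ sumOver-tabulate h O.from ⟨
    sumOver h (tabulate O.from)
      ≡⟨ sumOver-filter (λ x → ¬? (x ≈? ε)) f (tabulate O.from) ⟨
    sumOver f G∖0
      ∎
    where
    open ≡-Reasoning
    -- The weight `f` set to zero at the identity, so that summing over `G∖0` becomes summing over
    -- the whole group, where inversion is a permutation.
    h : Carrier → ℕ
    h x = indicator (¬? (x ≈? ε)) * f x

    h-cong : Respects≈ h
    h-cong {x} {y} x≈y = cong₂ _*_
      (indicator-cong (¬? (x ≈? ε)) (¬? (y ≈? ε))
        (λ x≉ε y≈ε → x≉ε (≈-trans x≈y y≈ε)) (λ y≉ε x≈ε → y≉ε (≈-trans (≈-sym x≈y) x≈ε)))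
      (f-cong x≈y)

    h-⁻¹ : ∀ x → indicator (¬? (x ≈? ε)) * f (x ⁻¹) ≡ h (x ⁻¹)
    h-⁻¹ x = cong (_* f (x ⁻¹)) (indicator-cong (¬? (x ≈? ε)) (¬? ((x ⁻¹) ≈? ε))
      (λ x≉ε x⁻¹≈ε → x≉ε (≈-trans (≈-sym (⁻¹-involutive x)) (≈-trans (⁻¹-cong x⁻¹≈ε) ε⁻¹≈ε)))
      (λ x⁻¹≉ε x≈ε → x⁻¹≉ε (≈-trans (⁻¹-cong x≈ε) ε⁻¹≈ε)))

  -- External differences of a family of blocks.

  module _ {m : ℕ} (𝓑 : Family m) where

    open Family 𝓑

    externalDifferences : Fin m → Multiset
    externalDifferences i = ⋃ (indicesExcept i) λ j → D (set i) (set j)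

    multiplier : Fin m → ℕ
    multiplier i = _/_ k̃ (size i) {{size-nonZero i}}

    -- The multiplier depends on the second block only. Making that block the outer index lets the
    -- multiplier leave the inner sum, and the swap of the blocks makes what remains the external
    -- differences that the PEDF condition controls.
    sumOver-weighted : ∀ {f} → Respects≈ f →
      sumOver f (⋃ (allFin m) λ i → ⋃ (indicesExcept i) λ j → D (set i) (weighted j)) ≡
      sumOver (λ j → multiplier j * sumOver (f ∘ _⁻¹) (externalDifferences j)) (allFin m)
    sumOver-weighted {f} f-cong = begin
      sumOver f (⋃ (allFin m) λ i → ⋃ (indicesExcept i) λ j → D (set i) (weighted j))
        ≡⟨ sumOver-concatMap f _ (allFin m) ⟩
      sumOver (λ i → sumOver f (⋃ (indicesExcept i) λ j → D (set i) (weighted j))) (allFin m)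
        ≡⟨ sumOver-cong (λ i → trans (sumOver-concatMap f _ (indicesExcept i))
             (sumOver-cong (λ j → trans (sumOver-D-⊠ f (set i) (multiplier j) (set j))
               (cong (multiplier j *_) (sumOver-D-swap f-cong (set i) (set j))))
               (indicesExcept i))) (allFin m) ⟩
      sumOver (λ i → sumOver (λ j → term j i) (indicesExcept i)) (allFin m)
        -- The two filters express the same symmetric condition, that the indices differ.
        ≡⟨ sumOver-filter-comm (λ i j → ¬? (j Fin.≟ i)) (λ j i → ¬? (i Fin.≟ j))
             (_∘ sym) (_∘ sym) (λ i j → term j i) (allFin m) (allFin m) ⟩
      sumOver (λ j → sumOver (term j) (indicesExcept j)) (allFin m)
        ≡⟨ sumOver-cong (λ j → trans (sumOver-*ˡ (multiplier j) _ (indicesExcept j))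
             (cong (multiplier j *_) (sym (sumOver-concatMap _ _ (indicesExcept j))))) (allFin m) ⟩
      sumOver (λ j → multiplier j * sumOver (f ∘ _⁻¹) (externalDifferences j)) (allFin m)
        ∎
      where
      open ≡-Reasoning
      term : Fin m → Fin m → ℕ
      term j i = multiplier j * sumOver (f ∘ _⁻¹) (D (set j) (set i))

    some∈ : ∀ i → ∃ (_∈ set i)
    some∈ i with set i | nonempty i
    ... | []    | ≢[] = contradiction refl ≢[]
    ... | x ∷ _ | _   = x , here refl

    -- The witness is a difference between elements of blocks `i` and `j`, both nonempty. Only the
    -- first block is restricted in size, so block `j` may have any size. This is the source of
    -- positivity below.
    ⋃-externalDifferences-inhabited : ∀ {i j} → j ≢ i →
      ∃ (_∈ ⋃ (indicesOfSize (size i)) externalDifferences)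
    ⋃-externalDifferences-inhabited {i} {j} j≢i
      with x , x∈ ← some∈ i | y , y∈ ← some∈ j =
      x - y ,
      ∈-concatMap⁺ externalDifferences (Any.map (λ where refl → x-y∈)
        (∈-filter⁺ (λ k → size k ≟ size i) (∈-allFin i) refl))
      where
      x-y∈ : x - y ∈ externalDifferences i
      x-y∈ = ∈-concatMap⁺ (λ k → D (set i) (set k))
        (Any.map (λ where refl → ∈-cartesianProductWith⁺ _-_ x∈ y∈)
          (∈-filter⁺ (λ k → ¬? (k Fin.≟ i)) (∈-allFin j) j≢i))

    -- Consequences of the PEDF condition: the weighted sum and the positivity of its coefficient.

    module _ {l : ℕ} {c w Λ : Fin l → ℕ} (pedf : IsPEDF 𝓑 c w Λ) where

      open IsPEDF pedf

      ratio : Fin l → ℕ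
      ratio t = _/_ (lcms w) (w t) {{w-nonZero t}}

      -- Truncated division may be regrouped here because `w t` divides `lcms w`.
      Λ-ratio : ∀ t → _/_ (Λ t * lcms w) (w t) {{w-nonZero t}} ≡ Λ t * ratio t
      Λ-ratio t = *-/-assoc (Λ t) {{w-nonZero t}} (lcms-∣ w t)

      -- The numerators agree although `k̃` runs over all blocks and `lcms w` over distinct sizes:
      -- by `w-allSizes` and `w-isSize` both families take the same values.
      multiplier≡ratio : ∀ t i → size i ≡ w t → multiplier i ≡ ratio t
      multiplier≡ratio t i size≡w = trans
        (/-congˡ {{size-nonZero i}} (lcms-cong size w w-allSizes w-isSize))
        (/-congʳ {{size-nonZero i}} {{w-nonZero t}} size≡w)

      differences-weighted : ∀ {f} → Respects≈ f →
        sumOver f (⋃ (allFin m) λ i → ⋃ (indicesExcept i) λ j → D (set i) (weighted j)) ≡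
        ∑ (λ t → _/_ (Λ t * lcms w) (w t) {{w-nonZero t}}) * sumOver f G∖0
      differences-weighted {f} f-cong = begin
        sumOver f (⋃ (allFin m) λ i → ⋃ (indicesExcept i) λ j → D (set i) (weighted j))
          ≡⟨ sumOver-weighted f-cong ⟩
        sumOver (λ j → multiplier j * S j) (allFin m)
          ≡⟨ sumOver-fibres size w w-distinct w-allSizes _ (allFin m) ⟩
        ∑ (λ t → sumOver (λ j → multiplier j * S j) (indicesOfSize (w t)))
          ≡⟨ sum-cong-≗ perSize ⟩
        ∑ (λ t → _/_ (Λ t * lcms w) (w t) {{w-nonZero t}} * sumOver f G∖0)
          ≡⟨ *-distribʳ-sum (sumOver f G∖0) (λ t → _/_ (Λ t * lcms w) (w t) {{w-nonZero t}}) ⟨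
        ∑ (λ t → _/_ (Λ t * lcms w) (w t) {{w-nonZero t}}) * sumOver f G∖0
          ∎
        where
        open ≡-Reasoning
        f⁻ : Carrier → ℕ
        f⁻ = f ∘ _⁻¹

        S : Fin m → ℕ
        S j = sumOver f⁻ (externalDifferences j)

        perSize : ∀ t → sumOver (λ j → multiplier j * S j) (indicesOfSize (w t)) ≡
                        _/_ (Λ t * lcms w) (w t) {{w-nonZero t}} * sumOver f G∖0
        perSize t = begin
          sumOver (λ j → multiplier j * S j) (indicesOfSize (w t))
            -- The multiplier is known to equal `ratio t` only inside the size class, so the
            -- rewriting takes place under the filter.
            ≡⟨ sumOver-filter-cong (λ j → size j ≟ w t)
                 (λ j eq → cong (_* S j) (multiplier≡ratio t j eq)) (allFin m) ⟩
          sumOver (λ j → ratio t * S j) (indicesOfSize (w t))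
            ≡⟨ sumOver-*ˡ (ratio t) S (indicesOfSize (w t)) ⟩
          ratio t * sumOver S (indicesOfSize (w t))
            ≡⟨ cong (ratio t *_) (sumOver-concatMap f⁻ _ (indicesOfSize (w t))) ⟨
          ratio t * sumOver f⁻ (⋃ (indicesOfSize (w t)) externalDifferences)
            -- The PEDF condition is tested with the inverted weight, which still respects `≈`.
            ≡⟨ cong (ratio t *_) (sumOver-↭ (f-cong ∘ ⁻¹-cong) (differences t)) ⟩
          ratio t * sumOver f⁻ (Λ t ⊠ G∖0)
            ≡⟨ cong (ratio t *_) (sumOver-⊠ f⁻ (Λ t) G∖0) ⟩
          ratio t * (Λ t * sumOver f⁻ G∖0)
            ≡⟨ *-assoc (ratio t) (Λ t) _ ⟨
          ratio t * Λ t * sumOver f⁻ G∖0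
            -- The inversion introduced by swapping the blocks is undone here.
            ≡⟨ cong₂ _*_ (trans (*-comm (ratio t) (Λ t)) (sym (Λ-ratio t))) (sumOver-G∖0-⁻¹ f-cong) ⟩
          _/_ (Λ t * lcms w) (w t) {{w-nonZero t}} * sumOver f G∖0
            ∎

      -- If `Λ t` were zero, the right side of the PEDF condition would be empty, while the left
      -- side contains a difference of blocks `i` and `j`. The constant weight 1 turns this into a
      -- comparison of cardinalities.
      Λ>0 : ∀ {i j} → j ≢ i → ∀ t → size i ≡ w t → Λ t > 0
      Λ>0 j≢i t size≡w with z , z∈ ← ⋃-externalDifferences-inhabited j≢i =
        n≢0⇒n>0 λ Λ≡0 → contradiction
          (begin
            1
              ≤⟨ ∈⇒≤sumOver (λ _ → 1) z∈′ ⟩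
            sumOver (λ _ → 1) (⋃ (indicesOfSize (w t)) externalDifferences)
              ≡⟨ sumOver-↭ (λ _ → refl) (differences t) ⟩
            sumOver (λ _ → 1) (Λ t ⊠ G∖0)
              ≡⟨ sumOver-⊠ (λ _ → 1) (Λ t) G∖0 ⟩
            Λ t * sumOver (λ _ → 1) G∖0
              ≡⟨ cong (_* sumOver (λ _ → 1) G∖0) Λ≡0 ⟩
            0
              ∎)
          λ ()
        where
        open ≤-Reasoning
        z∈′ : z ∈ ⋃ (indicesOfSize (w t)) externalDifferences
        z∈′ = subst (λ s → z ∈ ⋃ (indicesOfSize s) externalDifferences) size≡w z∈

      -- A divisor of a nonzero number is at most that number; the lcm is nonzero because all block
      -- sizes are.
      ratio>0 : ∀ t → ratio t > 0
      ratio>0 t = m≥n⇒m/n>0 {{w-nonZero t}}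
        (∣⇒≤ {{lcms-nonZero w w-nonZero}} (lcms-∣ w t))

      -- A single positive term suffices, and the one for the size of block `i` is a product of two
      -- positive factors.
      ∑Λ>0 : ∀ {i j : Fin m} → j ≢ i → ∑ (λ t → _/_ (Λ t * lcms w) (w t) {{w-nonZero t}}) > 0
      ∑Λ>0 {i} j≢i with t , size≡w ← w-allSizes i =
        ≤-trans (subst (_> 0) (sym (Λ-ratio t)) (*-mono-≤ (Λ>0 j≢i t size≡w) (ratio>0 t)))
          (term≤∑ _ t)

lemma6 : ∀ {g ℓ} (G : AbelianGroup g ℓ) {n : ℕ} (order : HasOrder G n) →
    let open DifferenceFamilies G order in
    ∀ {m l : ℕ} → 2 ≤ m →
    (𝓑 : Family m) (c w Λ : Fin l → ℕ) (pedf : IsPEDF 𝓑 c w Λ) →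
    let open Family 𝓑 using (size)
        open IsPEDF pedf using (w-nonZero)
    in IsSWEDF 𝓑 size (∑ size) (∑ (λ t → _/_ (Λ t * lcms w) (w t) {{w-nonZero t}}))
lemma6 G order (s≤s (s≤s _)) 𝓑 c w Λ pedf = record
  { K-sizes     = λ _ → refl
  ; a-total     = refl
  -- The bound `2 ≤ m` supplies the two distinct indices 0 and 1.
  ; Λ-positive  = ∑Λ>0 G order 𝓑 pedf {zero} {suc zero} λ ()
  ; differences = sumOver≡⇒↭ G order _ _ λ f f-cong →
      trans (differences-weighted G order 𝓑 pedf f-cong)
        (sym (sumOver-⊠ G order f _ (DifferenceFamilies.G∖0 G order)))
  }
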